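{- Let $N(r,3;n)$ denote the number of partitions of $n$ whose rank is congruent to $r$ modulo $3$. Then: (i) for all integers $a,b\ge 12$, $N(0,3;a)\,N(0,3;b) > N(0,3;a+b)$; (ii) for $r\in\{1,2\}$ and all integers $a,b\ge 11$, $N(r,3;a)\,N(r,3;b) > N(r,3;a+b)$.
   Context: A partition of a nonnegative integer $n$ is a finite nonincreasing sequence of positive integers $\lambda=(\lambda_1,\dots,\lambda_k)$ with $\lambda_1+\dots+\lambda_k=n$. The (Dyson) rank of $\lambda$ is $\lambda_1-k$ (largest part minus number of parts). For integers $r$ and $t\ge 1$, $N(r,t;n)$ is the number of partitions of $n$ whose rank is $\equiv r \pmod t$. -}

module Defs where

open import Data.Nat using (ℕ; zero; suc; _+_; _∸_; _≤_; _<_; NonZero)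
open import Data.Nat.Properties using (_≤?_)
open import Data.Integer as ℤ using (ℤ; +_; _-_; _%ℕ_)
open import Data.List using (List; []; _∷_; length; filter; concatMap; map)
open import Data.Nat.ListAction using (sum)
open import Data.List.Relation.Unary.All using (All)
open import Data.List.Relation.Unary.Linked using (Linked)
open import Data.Nat using (_≥_)
open import Relation.Binary.PropositionalEquality using (_≡_)
open import Relation.Nullary using (Dec; yes; no)
import Data.Nat as ℕ

largest : List ℕ → ℕ
largest []      = 0
largest (p ∷ _) = p

rank : List ℕ → ℤ
rank λs = + largest λs - + length λs

-- partsLe m n : all partitions of n (as nonincreasing lists of positive
-- integers) whose parts are all ≤ m.  Fuel k bounds recursion (k ≥ n suffices).
partsLe : (fuel : ℕ) → (m n : ℕ) → List (List ℕ)
partsLe _        _ zero    = [] ∷ []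
partsLe zero     _ (suc _) = []
partsLe (suc k)  m (suc n) = concatMap choose (Data.List.upTo (suc n))
  where
    choose : ℕ → List (List ℕ)
    choose p with suc p ≤? m
    ... | no _  = []
    ... | yes _ = map (suc p ∷_) (partsLe k (suc p) (suc n ∸ suc p))

partitions : ℕ → List (List ℕ)
partitions n = partsLe n n n

N : (r : ℤ) (t : ℕ) → .{{NonZero t}} → ℕ → ℕ
N r t n = length (filter (λ λs → (rank λs %ℕ t) ℕ.≟ (r %ℕ t)) (partitions n))

{-# OPTIONS --safe #-}
module Submission where

-- Write p(n) for the number of partitions of n and q m n for the number of those with all parts ≤ m.
-- Adding 1 to the largest part raises the rank by 1, and appending a part 1 lowers it by 1. Doing this twice
-- maps partitions of n injectively to partitions of n + 2 of any wanted residue class, so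
-- p(n − 2) ≤ 3 N(r,3;n) ≤ p(n + 2). Apart from finitely many pairs, the theorem thus follows from
-- 3 p(x + y + 6) < p(x) p(y) for x ≥ 9 and y ≥ 56.
--
-- This is proved for q m in place of p. Because q m n = q (m − 1) n + q m (n − m), the inequality for (m, x, y)
-- follows from those for (m − 1, x, y) and (m, x, y − m), so up to m = 23 only x < 9 + m, y < 56 + m remain,
-- a finite check, which even gives the factor 10/3 instead of 3. For larger m the same recursion works as long
-- as y − m ≥ 56. The levels m > y − 56 together add at most (x + 62) q m (x + 62) to q m (x + y + 6), which by
-- induction on x + y is at most (x + 62) p(56) q m x / 3; the surplus from level 23, proportional to
-- q m x · q 23 y, pays for it as soon as y ≥ 120.

open import Defs
open import Data.Bool using (Bool; true; false; if_then_else_; _∧_; T)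
open import Data.Integer using (ℤ; +_; -[1+_]; _⊖_; _%ℕ_)
open import Data.Integer.Properties using ([1+m]⊖[1+n]≡m⊖n)
open import Data.List using (List; []; _∷_; _++_; map; concatMap; length; filter; replicate; applyUpTo; applyDownFrom)
open import Data.List.Properties using (map-++; map-∘; map-cong)
open import Data.Nat
open import Data.Nat.DivMod using (_%_)
open import Data.Nat.ListAction using (sum)
open import Data.Nat.ListAction.Properties using (sum-++)
open import Data.Nat.Properties
open import Data.Nat.Tactic.RingSolver using (solve-∀)
open import Data.Product using (_×_; _,_; proj₁; proj₂)
open import Data.Sum using (_⊎_; inj₁; inj₂)
open import Data.Unit using (tt)
open import Function using (_∘_; id)
open import Level using (0ℓ)
open import Relation.Binary.PropositionalEquality
open import Relation.Nullary
open import Relation.Unary using (Pred; Decidable)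
open import Algebra.Properties.CommutativeSemigroup +-commutativeSemigroup using (interchange)

-- Finite sums

Σ< : ℕ → (ℕ → ℕ) → ℕ
Σ< n f = sum (applyUpTo f n)

Σ<-cong : ∀ n {f g : ℕ → ℕ} → (∀ i → i < n → f i ≡ g i) → Σ< n f ≡ Σ< n g
Σ<-cong zero    h = refl
Σ<-cong (suc n) h = cong₂ _+_ (h 0 z<s) (Σ<-cong n (λ i i<n → h (suc i) (s<s i<n)))

Σ<-mono : ∀ n {f g : ℕ → ℕ} → (∀ i → i < n → f i ≤ g i) → Σ< n f ≤ Σ< n g
Σ<-mono zero    h = z≤n
Σ<-mono (suc n) h = +-mono-≤ (h 0 z<s) (Σ<-mono n (λ i i<n → h (suc i) (s<s i<n)))

Σ<-≤-suc : ∀ n (f : ℕ → ℕ) → Σ< n f ≤ Σ< (suc n) f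
Σ<-≤-suc zero    f = z≤n
Σ<-≤-suc (suc n) f = +-monoʳ-≤ (f 0) (Σ<-≤-suc n (f ∘ suc))

Σ<-+ : ∀ n (f g : ℕ → ℕ) → Σ< n f + Σ< n g ≡ Σ< n (λ i → f i + g i)
Σ<-+ zero    f g = refl
Σ<-+ (suc n) f g = trans (interchange (f 0) _ (g 0) _) (cong (_+_ (f 0 + g 0)) (Σ<-+ n (f ∘ suc) (g ∘ suc)))

-- The form in which `partsLe` sums over the largest part: index `p` stands for the part `suc p`,
-- and `p <ᵇ m` is the test `suc p ≤ m`.
Σ<-guarded : ℕ → ℕ → (ℕ → ℕ) → ℕ
Σ<-guarded m n f = Σ< n (λ p → if p <ᵇ m then f p else 0)

Σ<-guarded-zero : ∀ n f → Σ<-guarded 0 n f ≡ 0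
Σ<-guarded-zero zero    f = refl
Σ<-guarded-zero (suc n) f = Σ<-guarded-zero n (f ∘ suc)

Σ<-guarded-suc : ∀ m k f → Σ<-guarded (suc m) (suc m + k) f ≡ Σ<-guarded m (suc m + k) f + f m
Σ<-guarded-suc zero    k f = +-comm (f 0) _
Σ<-guarded-suc (suc m) k f =
  trans (cong (_+_ (f 0)) (Σ<-guarded-suc m k (f ∘ suc))) (sym (+-assoc (f 0) _ _))

Σ<-guarded-all : ∀ {m n} f → n ≤ m → Σ<-guarded m n f ≡ Σ< n f
Σ<-guarded-all f z≤n       = refl
Σ<-guarded-all f (s≤s n≤m) = cong (_+_ (f 0)) (Σ<-guarded-all (f ∘ suc) n≤m)

-- Weighted sums over lists of partitions

total : {A : Set} → (A → ℕ) → List A → ℕ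
total w xs = sum (map w xs)

total-cong : {A : Set} {w v : A → ℕ} → (∀ x → w x ≡ v x) → ∀ xs → total w xs ≡ total v xs
total-cong h xs = cong sum (map-cong h xs)

total-map : {A B : Set} (w : B → ℕ) (f : A → B) → ∀ xs → total w (map f xs) ≡ total (w ∘ f) xs
total-map w f xs = cong sum (sym (map-∘ xs))

total-++ : {A : Set} (w : A → ℕ) → ∀ xs ys → total w (xs ++ ys) ≡ total w xs + total w ys
total-++ w xs ys = trans (cong sum (map-++ w xs ys)) (sum-++ (map w xs) (map w ys))

total-concatMap-applyUpTo : {A : Set} (w : A → ℕ) (f g : ℕ → List A) (h : ℕ → ℕ) → ∀ n →
  (∀ i → f (h i) ≡ g i) → total w (concatMap f (applyUpTo h n)) ≡ Σ< n (total w ∘ g)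
total-concatMap-applyUpTo w f g h zero    eq = refl
total-concatMap-applyUpTo w f g h (suc n) eq =
  trans (total-++ w (f (h 0)) (concatMap f (applyUpTo (h ∘ suc) n)))
        (cong₂ _+_ (cong (total w) (eq 0)) (total-concatMap-applyUpTo w f (g ∘ suc) (h ∘ suc) n (eq ∘ suc)))

-- The omitted left-hand side is the value at suc p of the function local to
-- partsLe k (suc m) (suc n), which has no name outside Defs; it is solved by the use in total-partsLe.
choose-suc : ∀ k m n p → _ ≡
  (if p <ᵇ m then map (suc (suc p) ∷_) (partsLe k (suc (suc p)) (n ∸ suc p)) else [])

-- The weight is arbitrary because passing to the other parts changes it to `λ λs → w (suc p ∷ λs)`.
total-partsLe : ∀ k m n (w : List ℕ → ℕ) → total w (partsLe (suc k) m (suc n)) ≡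
  Σ<-guarded m (suc n) (λ p → total (λ λs → w (suc p ∷ λs)) (partsLe k (suc p) (n ∸ p)))
-- For `m = 0` and for the part 1 the test inside `choose` computes; only larger parts need
-- `choose-suc`.
total-partsLe k zero n w =
  trans (total-concatMap-applyUpTo w _ (λ _ → []) suc n (λ _ → refl)) (Σ<-cong n (λ _ _ → refl))
total-partsLe k (suc m) n w =
  trans (total-++ w (map (1 ∷_) (partsLe k 1 n)) _)
        (cong₂ _+_ (total-map w (1 ∷_) (partsLe k 1 n))
          (trans (total-concatMap-applyUpTo w _ _ suc n (choose-suc k m n))
                 (Σ<-cong n (λ p _ → total-if p))))
  where
  total-if : ∀ p → total w (if p <ᵇ m then map (suc (suc p) ∷_) (partsLe k (suc (suc p)) (n ∸ suc p)) else []) ≡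
    (if p <ᵇ m then total (λ λs → w (suc (suc p) ∷ λs)) (partsLe k (suc (suc p)) (n ∸ suc p)) else 0)
  total-if p with p <ᵇ m
  ... | true  = total-map w (suc (suc p) ∷_) (partsLe k (suc (suc p)) (n ∸ suc p))
  ... | false = refl

choose-suc k m n p with suc (suc p) ≤? suc m
choose-suc k m n p | yes (s≤s p<m) with p <ᵇ m | <ᵇ-reflects-< p m
... | true  | _       = refl
... | false | ofⁿ p≮m = contradiction p<m p≮m
choose-suc k m n p | no p≮m with p <ᵇ m | <ᵇ-reflects-< p m
... | true  | ofʸ p<m = contradiction (s≤s p<m) p≮m
... | false | _       = refl

Σ<-guarded-cong : ∀ m n {f g : ℕ → ℕ} → (∀ i → f i ≡ g i) → Σ<-guarded m n f ≡ Σ<-guarded m n g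
Σ<-guarded-cong m n h = Σ<-cong n (λ p _ → cong (λ v → if p <ᵇ m then v else 0) (h p))

-- Needed because `c` takes `n` itself as fuel, whereas the recursive calls may leave more.
total-partsLe-fuel : ∀ k k′ m n (w : List ℕ → ℕ) → n ≤ k → n ≤ k′ →
  total w (partsLe k m n) ≡ total w (partsLe k′ m n)
total-partsLe-fuel k k′ m zero w _ _ = refl
total-partsLe-fuel (suc k) (suc k′) m (suc n) w (s≤s n≤k) (s≤s n≤k′) =
  trans (total-partsLe k m n w)
    (trans (Σ<-guarded-cong m (suc n) (λ p → total-partsLe-fuel k k′ (suc p) (n ∸ p) (λ λs → w (suc p ∷ λs))
             (≤-trans (m∸n≤m n p) n≤k) (≤-trans (m∸n≤m n p) n≤k′)))
           (sym (total-partsLe k′ m n w)))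

-- Counting by the number of parts modulo 3

ind : ℕ → ℕ
ind 0 = 1
ind 1 = 0
ind 2 = 0
ind (suc (suc (suc t))) = ind t

-- Twice the length replaces minus the length, which is the same modulo 3 and stays in ℕ.
weight : ℕ → List ℕ → ℕ
weight t λs = ind (length λs * 2 + t)

weight-∷ : ∀ t p λs → weight t (p ∷ λs) ≡ weight (2 + t) λs
weight-∷ t p λs = cong ind (sym (trans (+-suc (length λs * 2) (suc t)) (cong suc (+-suc (length λs * 2) t))))

opaque
  -- Counts the partitions of `n` into parts at most `m` whose number of parts is `t` modulo 3,
  -- since `2 l + t ≡ 0` means `l ≡ t`. Opaque, so that the list of partitions is never unfolded.
  c : ℕ → ℕ → ℕ → ℕ
  c m n t = total (weight t) (partsLe n m n)

  c-zero : ∀ m t → c m 0 t ≡ ind t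
  c-zero m t = +-identityʳ (ind t)

  c-partsLe : ∀ {k n} → n ≤ k → ∀ m t → total (weight t) (partsLe k m n) ≡ c m n t
  c-partsLe {k} {n} n≤k m t = total-partsLe-fuel k n m n (weight t) n≤k ≤-refl

c-suc : ∀ m n t → c m (suc n) t ≡ Σ<-guarded m (suc n) (λ p → c (suc p) (n ∸ p) (2 + t))
c-suc m n t = trans (sym (c-partsLe ≤-refl m t)) (trans (total-partsLe n m n (weight t))
  (Σ<-guarded-cong m (suc n) (λ p →
    trans (total-cong (weight-∷ t (suc p)) (partsLe n (suc p) (n ∸ p))) (c-partsLe (m∸n≤m n p) (suc p) (2 + t)))))

c-zero-suc : ∀ n t → c 0 (suc n) t ≡ 0
c-zero-suc n t = trans (c-suc 0 n t) (Σ<-guarded-zero (suc n) (λ p → c (suc p) (n ∸ p) (2 + t)))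

c-saturate : ∀ {m n} → n ≤ m → ∀ t → c (suc m) n t ≡ c m n t
c-saturate {m} {zero}  _   t = trans (c-zero (suc m) t) (sym (c-zero m t))
c-saturate {m} {suc n} n<m t = begin
  c (suc m) (suc n) t            ≡⟨ c-suc (suc m) n t ⟩
  Σ<-guarded (suc m) (suc n) f   ≡⟨ Σ<-guarded-all f (m≤n⇒m≤1+n n<m) ⟩
  Σ< (suc n) f                   ≡⟨ Σ<-guarded-all f n<m ⟨
  Σ<-guarded m (suc n) f         ≡⟨ c-suc m n t ⟨
  c m (suc n) t                  ∎
  where
  open ≡-Reasoning
  f : ℕ → ℕ
  f p = c (suc p) (n ∸ p) (2 + t)

-- The last term of the sum over the largest part belongs to `suc m`. Removing that part lowers the
-- number of parts by 1, and `2 + t` stands for `t − 1`.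
c-step : ∀ m n t → c (suc m) (suc m + n) t ≡ c m (suc m + n) t + c (suc m) n (2 + t)
c-step m n t = begin
  c (suc m) (suc m + n) t                                         ≡⟨ c-suc (suc m) (m + n) t ⟩
  Σ<-guarded (suc m) (suc m + n) f                                ≡⟨ Σ<-guarded-suc m n f ⟩
  Σ<-guarded m (suc m + n) f + c (suc m) (m + n ∸ m) (2 + t)      ≡⟨ cong₂ _+_ (sym (c-suc m (m + n) t))
                                                                       (cong (λ i → c (suc m) i (2 + t)) (m+n∸m≡n m n)) ⟩
  c m (suc m + n) t + c (suc m) n (2 + t)                         ∎
  where
  open ≡-Reasoning
  f : ℕ → ℕ
  f p = c (suc p) (m + n ∸ p) (2 + t)

c-periodic : ∀ m n t → c m n (3 + t) ≡ c m n t
c-periodic m n t = trans (sym (c-partsLe ≤-refl m (3 + t))) (trans (total-cong eq (partsLe n m n)) (c-partsLe ≤-refl m t))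
  where
  eq : ∀ λs → weight (3 + t) λs ≡ weight t λs
  eq λs = cong ind (trans (+-suc (length λs * 2) (2 + t))
    (cong suc (trans (+-suc (length λs * 2) (1 + t)) (cong suc (+-suc (length λs * 2) t)))))

window-induction : (P : ℕ → Set) (a m : ℕ) → (∀ i → i < suc m → P (a + i)) →
  (∀ n → a ≤ n → P n → P (suc m + n)) → ∀ n → a ≤ n → P n
window-induction P a m base step n a≤n =
  subst P (m+[n∸m]≡n a≤n) (go (suc (n ∸ a)) (n ∸ a) ≤-refl)
  where
  -- The bound `b` makes the recursion in steps of `suc m` structural.
  go : ∀ b j → j < b → P (a + j)
  go (suc b) j (s≤s j≤b) with j <? suc m
  ... | yes j<m = base j j<m
  ... | no  j≮m = subst P eq (step (a + (j ∸ suc m)) (m≤m+n a _) (go b (j ∸ suc m) lt))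
    where
    m<j : suc m ≤ j
    m<j = ≮⇒≥ j≮m
    eq : suc m + (a + (j ∸ suc m)) ≡ a + j
    eq = trans (sym (+-assoc (suc m) a _)) (trans (cong (λ s → s + (j ∸ suc m)) (+-comm (suc m) a))
           (trans (+-assoc a (suc m) _) (cong (λ s → a + s) (m+[n∸m]≡n m<j))))
    lt : j ∸ suc m < b
    lt = <-≤-trans (∸-monoʳ-< {j} {suc m} {0} z<s m<j) j≤b

step-induction : (P : ℕ → Set) (m : ℕ) → (∀ n → n ≤ m → P n) → (∀ n → P n → P (suc m + n)) → ∀ n → P n
step-induction P m base step n = window-induction P 0 m (λ i i<m → base i (≤-pred i<m)) (λ i _ → step i) n z≤n

c-mono-m : ∀ m n t → c m n t ≤ c (suc m) n t
c-mono-m m n t with n ≤? m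
... | yes n≤m = ≤-reflexive (sym (c-saturate n≤m t))
... | no  n≰m = subst (λ i → c m i t ≤ c (suc m) i t) (m+[n∸m]≡n (≰⇒> n≰m))
                  (subst (c m (suc m + (n ∸ suc m)) t ≤_) (sym (c-step m (n ∸ suc m) t)) (m≤m+n _ _))

-- The injection behind this appends a part 1.
c-append : ∀ m n t → c (suc m) n t ≤ c (suc m) (suc n) (suc t)
c-append zero n = step-induction (λ n → ∀ t → c 1 n t ≤ c 1 (suc n) (suc t)) 0
  (λ { zero z≤n t → ≤-reflexive (sym (trans (c-step 0 0 (suc t)) (trans (cong (λ s → s + c 1 0 (3 + t)) (c-zero-suc 0 (suc t))) (c-periodic 1 0 t)))) })
  (λ n ih t → subst₂ _≤_
    (sym (trans (c-step 0 n t) (cong (λ s → s + c 1 n (2 + t)) (c-zero-suc n t))))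
    (sym (trans (c-step 0 (suc n) (suc t)) (cong (λ s → s + c 1 (suc n) (3 + t)) (c-zero-suc (suc n) (suc t)))))
    (ih (2 + t))) n
-- `c-step` splits both sides at the part `2 + m`: partitions without it are compared by induction
-- on `m`, the others by induction on `n`. For `n ≤ suc m` it cannot occur on the left.
c-append (suc m) n = step-induction (λ n → ∀ t → c (2 + m) n t ≤ c (2 + m) (suc n) (suc t)) (suc m)
  (λ n n≤m t → ≤-trans (≤-reflexive (c-saturate n≤m t)) (≤-trans (c-append m n t) (c-mono-m (suc m) (suc n) (suc t))))
  (λ n ih t → subst₂ _≤_ (sym (c-step (suc m) n t))
     (sym (trans (cong (λ i → c (2 + m) i (suc t)) (sym (+-suc (2 + m) n)))
       (trans (c-step (suc m) (suc n) (suc t))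
         (cong (λ i → c (suc m) i (suc t) + c (2 + m) (suc n) (3 + t)) (+-suc (2 + m) n)))))
     (+-mono-≤ (c-append m (2 + m + n) t) (ih (2 + t)))) n

-- Ranks modulo 3

length-filter-total : {A : Set} {P : Pred A 0ℓ} (P? : Decidable P) → ∀ xs →
  length (filter P? xs) ≡ total (λ x → if does (P? x) then 1 else 0) xs
length-filter-total P? []       = refl
length-filter-total P? (x ∷ xs) with does (P? x)
... | true  = cong suc (length-filter-total P? xs)
... | false = length-filter-total P? xs

-- Modulo 3, subtracting `k` is adding `2 k`.
⊖-%3 : ∀ l k → (l ⊖ k) %ℕ 3 ≡ (k * 2 + l) % 3
⊖-%3 l       zero    = refl
⊖-%3 zero    (suc k) = trans (neg k) (cong (_% 3) (sym (+-identityʳ (suc k * 2))))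
  where
  neg : ∀ k → -[1+ k ] %ℕ 3 ≡ (suc k * 2) % 3
  neg 0 = refl
  neg 1 = refl
  neg 2 = refl
  neg (suc (suc (suc k))) = neg k
⊖-%3 (suc l) (suc k) = begin
  (suc l ⊖ suc k) %ℕ 3     ≡⟨ cong (_%ℕ 3) ([1+m]⊖[1+n]≡m⊖n l k) ⟩
  (l ⊖ k) %ℕ 3             ≡⟨ ⊖-%3 l k ⟩
  (3 + (k * 2 + l)) % 3    ≡⟨ cong (λ s → (2 + s) % 3) (+-suc (k * 2) l) ⟨
  (suc k * 2 + suc l) % 3  ∎
  where open ≡-Reasoning

%3-≟ : ∀ r → r < 3 → ∀ s → (if does (s % 3 ≟ r % 3) then 1 else 0) ≡ ind (s + r * 2)
%3-≟ r r<3 (suc (suc (suc s))) = %3-≟ r r<3 s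
%3-≟ 0 _ 0 = refl
%3-≟ 0 _ 1 = refl
%3-≟ 0 _ 2 = refl
%3-≟ 1 _ 0 = refl
%3-≟ 1 _ 1 = refl
%3-≟ 1 _ 2 = refl
%3-≟ 2 _ 0 = refl
%3-≟ 2 _ 1 = refl
%3-≟ 2 _ 2 = refl
%3-≟ (suc (suc (suc r))) (s≤s (s≤s (s≤s ()))) s

rank-weight : ∀ r → r < 3 → ∀ p λs →
  (if does ((rank (suc p ∷ λs) %ℕ 3) ≟ (+ r %ℕ 3)) then 1 else 0) ≡ weight (p + r * 2) λs
rank-weight r r<3 p λs = begin
  (if does ((rank (suc p ∷ λs) %ℕ 3) ≟ (r % 3)) then 1 else 0)
    ≡⟨ cong (λ s → if does (s ≟ r % 3) then 1 else 0) (⊖-%3 (suc p) (suc (length λs))) ⟩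
  (if does (((suc (length λs) * 2 + suc p) % 3) ≟ (r % 3)) then 1 else 0)
    ≡⟨ %3-≟ r r<3 (suc (length λs) * 2 + suc p) ⟩
  ind (2 + (length λs * 2 + suc p + r * 2))
    -- Moving `suc` outwards completes a 3, which `ind` drops by computation.
    ≡⟨ cong (λ s → ind (2 + (s + r * 2))) (+-suc (length λs * 2) p) ⟩
  ind (length λs * 2 + p + r * 2)
    ≡⟨ cong ind (+-assoc (length λs * 2) p (r * 2)) ⟩
  weight (p + r * 2) λs ∎
  where open ≡-Reasoning

-- Partitions of n > 0 with rank ≡ r (mod 3), by their largest part suc k: for the list λ of the other parts,
-- suc k − (1 + length λ) ≡ r means 2 · length λ + k + 2 r ≡ 0. At n = 0 this is 0, whereas N (+ 0) 3 0 is 1.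
R : ℕ → ℕ → ℕ
R r n = Σ< n (λ k → c (suc k) (n ∸ suc k) (k + r * 2))

N≡R : ∀ r → r < 3 → ∀ n → N (+ r) 3 (suc n) ≡ R r (suc n)
N≡R r r<3 n = begin
  N (+ r) 3 (suc n)                         ≡⟨ length-filter-total P? (partitions (suc n)) ⟩
  total w (partsLe (suc n) (suc n) (suc n)) ≡⟨ total-partsLe n (suc n) n w ⟩
  Σ<-guarded (suc n) (suc n) f              ≡⟨ Σ<-guarded-all f (≤-refl {suc n}) ⟩
  Σ< (suc n) f                              ≡⟨ Σ<-cong (suc n) (λ p _ →
    trans (total-cong (rank-weight r r<3 p) (partsLe n (suc p) (n ∸ p))) (c-partsLe (m∸n≤m n p) (suc p) (p + r * 2))) ⟩
  R r (suc n)                               ∎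
  where
  open ≡-Reasoning
  P? : ∀ λs → Dec ((rank λs %ℕ 3) ≡ (+ r %ℕ 3))
  P? λs = (rank λs %ℕ 3) ≟ (+ r %ℕ 3)
  w : List ℕ → ℕ
  w λs = if does (P? λs) then 1 else 0
  f : ℕ → ℕ
  f p = total (λ λs → w (suc p ∷ λs)) (partsLe n (suc p) (n ∸ p))

-- Rank classes compared with all partitions

q : ℕ → ℕ → ℕ
q m n = c m n 0 + c m n 1 + c m n 2

-- The term for largest part `suc k` goes to the term for `2 + k`, with the same other parts; the
-- right-hand term for largest part 1 is dropped.
R-raise-largest : ∀ r n → R r n ≤ R (suc r) (suc n)
R-raise-largest r n = ≤-trans (Σ<-mono n term) (m≤n+m _ _)
  where
  term : ∀ k → k < n → c (suc k) (n ∸ suc k) (k + r * 2) ≤ c (2 + k) (n ∸ suc k) (suc k + suc r * 2)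
  term k _ = ≤-trans (c-mono-m (suc k) (n ∸ suc k) (k + r * 2)) (≤-reflexive (sym (trans
    (cong (c (2 + k) (n ∸ suc k) ∘ suc) (trans (+-suc k (suc (r * 2))) (cong suc (+-suc k (r * 2)))))
    (c-periodic (2 + k) (n ∸ suc k) (k + r * 2)))))

-- `2 + r` stands for `r − 1`. The part 1 is appended to the parts other than the largest, by
-- `c-append`.
R-append : ∀ r n → R r n ≤ R (2 + r) (suc n)
R-append r n = ≤-trans (Σ<-mono n term) (Σ<-≤-suc n (λ k → c (suc k) (n ∸ k) (k + (2 + r) * 2)))
  where
  shift : ∀ k r → k + (2 + r) * 2 ≡ 4 + (k + r * 2)
  shift = solve-∀
  term : ∀ k → k < n → c (suc k) (n ∸ suc k) (k + r * 2) ≤ c (suc k) (n ∸ k) (k + (2 + r) * 2)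
  term k k<n = begin
    c (suc k) (n ∸ suc k) (k + r * 2)             ≤⟨ c-append k (n ∸ suc k) (k + r * 2) ⟩
    c (suc k) (suc (n ∸ suc k)) (1 + (k + r * 2)) ≡⟨ cong (λ i → c (suc k) i (1 + (k + r * 2))) (+-∸-assoc 1 k<n) ⟨
    c (suc k) (n ∸ k) (1 + (k + r * 2))           ≡⟨ c-periodic (suc k) (n ∸ k) (1 + (k + r * 2)) ⟨
    c (suc k) (n ∸ k) (4 + (k + r * 2))           ≡⟨ cong (c (suc k) (n ∸ k)) (shift k r) ⟨
    c (suc k) (n ∸ k) (k + (2 + r) * 2)           ∎
    where open ≤-Reasoning

R-periodic : ∀ r n → R (3 + r) n ≡ R r n
R-periodic r n = Σ<-cong n (λ k _ → trans
  (cong (c (suc k) (n ∸ suc k)) (shift k r))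
  (trans (c-periodic (suc k) (n ∸ suc k) (3 + (k + r * 2))) (c-periodic (suc k) (n ∸ suc k) (k + r * 2))))
  where
  shift : ∀ k r → k + (3 + r) * 2 ≡ 6 + (k + r * 2)
  shift = solve-∀

c-sum-shift : ∀ m n t → c m n t + c m n (1 + t) + c m n (2 + t) ≡ q m n
c-sum-shift m n zero    = refl
c-sum-shift m n (suc t) = begin
  c m n (1 + t) + c m n (2 + t) + c m n (3 + t) ≡⟨ cong (_+_ (c m n (1 + t) + c m n (2 + t))) (c-periodic m n t) ⟩
  c m n (1 + t) + c m n (2 + t) + c m n t       ≡⟨ +-comm _ (c m n t) ⟩
  c m n t + (c m n (1 + t) + c m n (2 + t))     ≡⟨ +-assoc (c m n t) _ _ ⟨
  c m n t + c m n (1 + t) + c m n (2 + t)       ≡⟨ c-sum-shift m n t ⟩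
  q m n                                         ∎
  where open ≡-Reasoning

q-Σ< : ∀ n → q (suc n) (suc n) ≡ Σ< (suc n) (λ k → q (suc k) (n ∸ k))
q-Σ< n = begin
  q (suc n) (suc n)                            ≡⟨ cong₂ _+_ (cong₂ _+_ (expand 0) (expand 1)) (expand 2) ⟩
  Σ< (suc n) (f 0) + Σ< (suc n) (f 1) + Σ< (suc n) (f 2)
    ≡⟨ cong (λ s → s + Σ< (suc n) (f 2)) (Σ<-+ (suc n) (f 0) (f 1)) ⟩
  Σ< (suc n) (λ k → f 0 k + f 1 k) + Σ< (suc n) (f 2)
    ≡⟨ Σ<-+ (suc n) (λ k → f 0 k + f 1 k) (f 2) ⟩
  Σ< (suc n) (λ k → f 0 k + f 1 k + f 2 k)
    ≡⟨ Σ<-cong (suc n) (λ k _ → c-sum-shift (suc k) (n ∸ k) 2) ⟩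
  Σ< (suc n) (λ k → q (suc k) (n ∸ k)) ∎
  where
  open ≡-Reasoning
  f : ℕ → ℕ → ℕ
  f t k = c (suc k) (n ∸ k) (2 + t)
  expand : ∀ t → c (suc n) (suc n) t ≡ Σ< (suc n) (f t)
  expand t = trans (c-suc (suc n) n t) (Σ<-guarded-all (f t) (≤-refl {suc n}))

-- In each term, raising `r` by 1 moves the last argument of `c` by 2, so the three classes run
-- through all residues.
R-total : ∀ r n → R r (suc n) + R (1 + r) (suc n) + R (2 + r) (suc n) ≡ q (suc n) (suc n)
R-total r n = begin
  R r (suc n) + R (1 + r) (suc n) + R (2 + r) (suc n)
    ≡⟨ cong (λ s → s + R (2 + r) (suc n)) (Σ<-+ (suc n) (f 0) (f 1)) ⟩
  Σ< (suc n) (λ k → f 0 k + f 1 k) + R (2 + r) (suc n)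
    ≡⟨ Σ<-+ (suc n) (λ k → f 0 k + f 1 k) (f 2) ⟩
  Σ< (suc n) (λ k → f 0 k + f 1 k + f 2 k)
    ≡⟨ Σ<-cong (suc n) (λ k _ → residues k) ⟩
  Σ< (suc n) (λ k → q (suc k) (n ∸ k))
    ≡⟨ q-Σ< n ⟨
  q (suc n) (suc n) ∎
  where
  open ≡-Reasoning
  f : ℕ → ℕ → ℕ
  f i k = c (suc k) (n ∸ k) (k + (i + r) * 2)
  residues : ∀ k → f 0 k + f 1 k + f 2 k ≡ q (suc k) (n ∸ k)
  residues k = begin
    f 0 k + f 1 k + f 2 k        ≡⟨ cong₂ (λ u v → d u₀ + d u + d v) (shift₁ k r) (shift₂ k r) ⟩
    d u₀ + d (2 + u₀) + d (4 + u₀) ≡⟨ cong (_+_ (d u₀ + d (2 + u₀))) (c-periodic (suc k) (n ∸ k) (1 + u₀)) ⟩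
    d u₀ + d (2 + u₀) + d (1 + u₀) ≡⟨ +-assoc (d u₀) _ _ ⟩
    d u₀ + (d (2 + u₀) + d (1 + u₀)) ≡⟨ cong (_+_ (d u₀)) (+-comm (d (2 + u₀)) _) ⟩
    d u₀ + (d (1 + u₀) + d (2 + u₀)) ≡⟨ +-assoc (d u₀) _ _ ⟨
    d u₀ + d (1 + u₀) + d (2 + u₀) ≡⟨ c-sum-shift (suc k) (n ∸ k) u₀ ⟩
    q (suc k) (n ∸ k)            ∎
    where
    d = c (suc k) (n ∸ k)
    u₀ = k + r * 2
    shift₁ : ∀ k r → k + (1 + r) * 2 ≡ 2 + (k + r * 2)
    shift₁ = solve-∀
    shift₂ : ∀ k r → k + (2 + r) * 2 ≡ 4 + (k + r * 2)
    shift₂ = solve-∀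

thrice : ∀ s → s + s + s ≡ 3 * s
thrice = solve-∀

-- Two moves lead from each class to `r`: up and down from `r`, twice up from `1 + r`, twice down
-- from `2 + r`.
q≤3R : ∀ r n → q (suc n) (suc n) ≤ 3 * R r (3 + n)
q≤3R r n = begin
  q (suc n) (suc n)                                     ≡⟨ R-total r n ⟨
  R r (suc n) + R (1 + r) (suc n) + R (2 + r) (suc n)   ≤⟨ +-mono-≤ (+-mono-≤
      (≤-trans (R-raise-largest r (suc n)) (≤-trans (R-append (1 + r) (2 + n)) (≤-reflexive (R-periodic r (3 + n)))))
      (≤-trans (R-raise-largest (1 + r) (suc n)) (≤-trans (R-raise-largest (2 + r) (2 + n)) (≤-reflexive (R-periodic r (3 + n))))))
      (≤-trans (R-append (2 + r) (suc n)) (≤-trans (R-append (4 + r) (2 + n))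
        (≤-reflexive (trans (R-periodic (3 + r) (3 + n)) (R-periodic r (3 + n)))))) ⟩
  R r (3 + n) + R r (3 + n) + R r (3 + n)               ≡⟨ thrice (R r (3 + n)) ⟩
  3 * R r (3 + n)                                       ∎
  where open ≤-Reasoning

-- Two moves lead from `r` into each class: up and down to `r`, twice down to `1 + r`, twice up to
-- `2 + r`.
3R≤q : ∀ r n → 3 * R r n ≤ q (2 + n) (2 + n)
3R≤q r n = begin
  3 * R r n                                               ≡⟨ thrice (R r n) ⟨
  R r n + R r n + R r n                                   ≤⟨ +-mono-≤ (+-mono-≤
      (≤-trans (R-raise-largest r n) (≤-trans (R-append (1 + r) (1 + n)) (≤-reflexive (R-periodic r (2 + n)))))
      (≤-trans (R-append r n) (≤-trans (R-append (2 + r) (1 + n)) (≤-reflexive (R-periodic (1 + r) (2 + n))))))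
      (≤-trans (R-raise-largest r n) (R-raise-largest (1 + r) (1 + n))) ⟩
  R r (2 + n) + R (1 + r) (2 + n) + R (2 + r) (2 + n)     ≡⟨ R-total r (1 + n) ⟩
  q (2 + n) (2 + n)                                       ∎
  where open ≤-Reasoning

-- Partitions with bounded parts

q-zero : ∀ m → q m 0 ≡ 1
q-zero m = cong₂ _+_ (cong₂ _+_ (c-zero m 0) (c-zero m 1)) (c-zero m 2)

q-zero-suc : ∀ n → q 0 (suc n) ≡ 0
q-zero-suc n = cong₂ _+_ (cong₂ _+_ (c-zero-suc n 0) (c-zero-suc n 1)) (c-zero-suc n 2)

q-saturate-suc : ∀ {m n} → n ≤ m → q (suc m) n ≡ q m n
q-saturate-suc n≤m = cong₂ _+_ (cong₂ _+_ (c-saturate n≤m 0) (c-saturate n≤m 1)) (c-saturate n≤m 2)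

q-step : ∀ m n → q (suc m) (suc m + n) ≡ q m (suc m + n) + q (suc m) n
q-step m n = begin
  q (suc m) s
    ≡⟨ cong₂ _+_ (cong₂ _+_ (c-step m n 0) (c-step m n 1)) (c-step m n 2) ⟩
  (c m s 0 + d 2) + (c m s 1 + d 3) + (c m s 2 + d 4)
    ≡⟨ cong (λ v → v + (c m s 2 + d 4)) (interchange (c m s 0) (d 2) (c m s 1) (d 3)) ⟩
  (c m s 0 + c m s 1) + (d 2 + d 3) + (c m s 2 + d 4)
    ≡⟨ interchange (c m s 0 + c m s 1) (d 2 + d 3) (c m s 2) (d 4) ⟩
  q m s + (d 2 + d 3 + d 4)
    ≡⟨ cong (_+_ (q m s)) (c-sum-shift (suc m) n 2) ⟩
  q m s + q (suc m) n ∎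
  where
  open ≡-Reasoning
  s = suc m + n
  d = c (suc m) n

q-mono-suc : ∀ m n → q m n ≤ q (suc m) n
q-mono-suc m n = +-mono-≤ (+-mono-≤ (c-mono-m m n 0) (c-mono-m m n 1)) (c-mono-m m n 2)

q-mono-m′ : ∀ m d n → q m n ≤ q (d + m) n
q-mono-m′ m zero    n = ≤-refl
q-mono-m′ m (suc d) n = ≤-trans (q-mono-m′ m d n) (q-mono-suc (d + m) n)

q-mono-m : ∀ {m m′} → m ≤ m′ → ∀ n → q m n ≤ q m′ n
q-mono-m {m} {m′} m≤m′ n = subst (λ i → q m n ≤ q i n) (m∸n+n≡m m≤m′) (q-mono-m′ m (m′ ∸ m) n)

q-saturate : ∀ d n → q (d + n) n ≡ q n n
q-saturate zero    n = refl
q-saturate (suc d) n = trans (q-saturate-suc (m≤n+m n d)) (q-saturate d n)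

-- From level `n` on the value at `n` is constant, hence maximal.
q≤q : ∀ m {n k} → n ≤ k → q m n ≤ q k n
q≤q m {n} n≤k = ≤-trans (≤-trans (q-mono-m (m≤m+n m n) n) (≤-reflexive (q-saturate m n))) (q-mono-m n≤k n)

-- A part 1 can be appended at every level but 0, where `q 0 0 = 1` and `q 0 1 = 0`.
q-mono-n-suc : ∀ m n → q (suc m) n ≤ q (suc m) (suc n)
q-mono-n-suc m n = ≤-trans (+-mono-≤ (+-mono-≤ (c-append m n 0) (c-append m n 1)) (c-append m n 2))
                           (≤-reflexive (c-sum-shift (suc m) (suc n) 1))

q-mono-n : ∀ m {n n′} → n ≤ n′ → q (suc m) n ≤ q (suc m) n′
q-mono-n m {n} {n′} n≤n′ = subst (λ i → q (suc m) n ≤ q (suc m) i) (m∸n+n≡m n≤n′) (go (n′ ∸ n))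
  where
  go : ∀ d → q (suc m) n ≤ q (suc m) (d + n)
  go zero    = ≤-refl
  go (suc d) = ≤-trans (go d) (q-mono-n-suc m (d + n))

q-pos : ∀ m n → 0 < q (suc m) n
q-pos m n = ≤-trans (≤-reflexive (sym (q-zero (suc m)))) (q-mono-n m z≤n)

q-one : ∀ n → q 1 n ≡ 1
q-one zero    = q-zero 1
q-one (suc n) = trans (q-step 0 n) (cong₂ _+_ (q-zero-suc n) (q-one n))

-- Tables of c

record Triple : Set where
  constructor triple
  field e₀ e₁ e₂ : ℕ
open Triple

entry : Triple → ℕ → ℕ
entry x 0 = e₀ x
entry x 1 = e₁ x
entry x 2 = e₂ x
entry x (suc (suc (suc t))) = entry x t

norm : Triple → ℕ
norm x = e₀ x + e₁ x + e₂ x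

infixl 6 _⊕_
-- The right operand is rotated, because `c-step` reads its second summand at residue `2 + t`.
_⊕_ : Triple → Triple → Triple
triple a b c ⊕ triple a′ b′ c′ = triple (a + c′) (b + a′) (c + b′)

nth : {A : Set} → A → List A → ℕ → A
nth z []       _       = z
nth z (x ∷ xs) zero    = x
nth z (x ∷ xs) (suc i) = nth z xs i

∅ : Triple
∅ = triple 0 0 0

⊕-∅ : ∀ x → x ⊕ ∅ ≡ x
⊕-∅ (triple a b c) = cong₂ (λ f z → f z) (cong₂ triple (+-identityʳ a) (+-identityʳ b)) (+-identityʳ c)

-- push names the new entry, so that it is shared between the row and its reversed prefix.
mutual
  nextRow : ℕ → List Triple → List Triple → List Triple
  nextRow m []       prefix = []
  nextRow m (x ∷ xs) prefix = push m (x ⊕ nth ∅ prefix m) xs prefix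

  push : ℕ → Triple → List Triple → List Triple → List Triple
  push m y xs prefix = y ∷ nextRow m xs (y ∷ prefix)

cs : ℕ → ℕ → Triple
cs m n = triple (c m n 0) (c m n 1) (c m n 2)

nth-applyUpTo : {A : Set} (z : A) (f : ℕ → A) → ∀ {n i} → i < n → nth z (applyUpTo f n) i ≡ f i
nth-applyUpTo z f {suc n} {zero}  _         = refl
nth-applyUpTo z f {suc n} {suc i} (s≤s i<n) = nth-applyUpTo z (f ∘ suc) i<n

nth-applyDownFrom-≥ : {A : Set} (z : A) (f : ℕ → A) → ∀ {n i} → n ≤ i → nth z (applyDownFrom f n) i ≡ z
nth-applyDownFrom-≥ z f {zero}          _         = refl
nth-applyDownFrom-≥ z f {suc n} {suc i} (s≤s n≤i) = nth-applyDownFrom-≥ z f n≤i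

nth-applyDownFrom : {A : Set} (z : A) (f : ℕ → A) → ∀ i n → nth z (applyDownFrom f (suc i + n)) i ≡ f n
nth-applyDownFrom z f zero    n = refl
nth-applyDownFrom z f (suc i) n = nth-applyDownFrom z f i n

-- In a row stored latest entry first, index `m` reaches back `suc m` places, as `c-step` requires.
-- For `n ≤ m` it runs off the list, and the default `∅` is right by `c-saturate`.
cs-step : ∀ m n → cs m n ⊕ nth ∅ (applyDownFrom (cs (suc m)) n) m ≡ cs (suc m) n
cs-step m n with n ≤? m
... | yes n≤m = begin
  cs m n ⊕ nth ∅ (applyDownFrom (cs (suc m)) n) m ≡⟨ cong (cs m n ⊕_) (nth-applyDownFrom-≥ ∅ (cs (suc m)) n≤m) ⟩
  cs m n ⊕ ∅                                      ≡⟨ ⊕-∅ (cs m n) ⟩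
  cs m n                                          ≡⟨ triple-cong (λ t → c-saturate n≤m t) ⟨
  cs (suc m) n                                    ∎
  where
  open ≡-Reasoning
  triple-cong : ∀ {f g : ℕ → ℕ} → (∀ t → f t ≡ g t) → triple (f 0) (f 1) (f 2) ≡ triple (g 0) (g 1) (g 2)
  triple-cong h rewrite h 0 | h 1 | h 2 = refl
... | no n≰m = subst (λ i → cs m i ⊕ nth ∅ (applyDownFrom (cs (suc m)) i) m ≡ cs (suc m) i)
                 (m+[n∸m]≡n (≰⇒> n≰m)) (go (n ∸ suc m))
  where
  go : ∀ j → cs m (suc m + j) ⊕ nth ∅ (applyDownFrom (cs (suc m)) (suc m + j)) m ≡ cs (suc m) (suc m + j)
  go j rewrite nth-applyDownFrom ∅ (cs (suc m)) m j
             | c-step m j 0 | c-step m j 1 | c-step m j 2 | c-periodic (suc m) j 0 | c-periodic (suc m) j 1 = refl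

-- The hypothesis on `f` absorbs the shifts `f ∘ suc` that `applyUpTo` produces.
nextRow-correct : ∀ m k n (f : ℕ → ℕ) → (∀ i → f i ≡ n + i) →
  nextRow m (applyUpTo (cs m ∘ f) k) (applyDownFrom (cs (suc m)) n) ≡ applyUpTo (cs (suc m) ∘ f) k
nextRow-correct m zero    n f eq = refl
nextRow-correct m (suc k) n f eq rewrite trans (eq 0) (+-identityʳ n) | cs-step m n =
  cong (cs (suc m) n ∷_) (nextRow-correct m k (suc n) (f ∘ suc) (λ i → trans (eq (suc i)) (+-suc n i)))

row₀ : ℕ → List Triple
row₀ zero    = []
row₀ (suc l) = triple 1 0 0 ∷ replicate l ∅

row₀-correct : ∀ l → row₀ l ≡ applyUpTo (cs 0) l
row₀-correct zero    = refl
row₀-correct (suc l) rewrite c-zero 0 0 | c-zero 0 1 | c-zero 0 2 = cong (triple 1 0 0 ∷_) (go l id)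
  where
  go : ∀ l (f : ℕ → ℕ) → replicate l ∅ ≡ applyUpTo (cs 0 ∘ suc ∘ f) l
  go zero    f = refl
  go (suc l) f rewrite c-zero-suc (f 0) 0 | c-zero-suc (f 0) 1 | c-zero-suc (f 0) 2 = cong (∅ ∷_) (go l (f ∘ suc))

nextRow≡ : ∀ m l → nextRow m (applyUpTo (cs m) l) [] ≡ applyUpTo (cs (suc m)) l
nextRow≡ m l = nextRow-correct m l 0 id (λ _ → refl)

rowsFrom : ℕ → List Triple → ℕ → List (List Triple)
rowsFrom m row zero    = row ∷ []
rowsFrom m row (suc k) = row ∷ rowsFrom (suc m) (nextRow m row []) k

table : ℕ → ℕ → List (List Triple)
table l k = rowsFrom 0 (row₀ l) k

nth-rowsFrom : ∀ l m k i → i ≤ k → nth [] (rowsFrom m (applyUpTo (cs m) l) k) i ≡ applyUpTo (cs (i + m)) l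
nth-rowsFrom l m zero    zero    _ = refl
nth-rowsFrom l m (suc k) zero    _ = refl
nth-rowsFrom l m (suc k) (suc i) (s≤s i≤k) rewrite nextRow≡ m l =
  trans (nth-rowsFrom l (suc m) k i i≤k) (cong (λ j → applyUpTo (cs j) l) (+-suc i m))

nth-table : ∀ l k i → i ≤ k → nth [] (table l k) i ≡ applyUpTo (cs i) l
nth-table l k i i≤k rewrite row₀-correct l =
  trans (nth-rowsFrom l 0 k i i≤k) (cong (λ j → applyUpTo (cs j) l) (+-identityʳ i))

cell : List (List Triple) → ℕ → ℕ → Triple
cell tab m n = nth ∅ (nth [] tab m) n

cell-correct : ∀ l k {m n} → m ≤ k → n < l → cell (table l k) m n ≡ cs m n
cell-correct l k {m} {n} m≤k n<l = trans (cong (λ r → nth ∅ r n) (nth-table l k m m≤k)) (nth-applyUpTo ∅ (cs m) n<l)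

qFrom : List (List Triple) → ℕ → ℕ → ℕ
qFrom tab m n = norm (cell tab m n)

-- Finite checks

all< : ℕ → (ℕ → Bool) → Bool
all< zero    f = true
all< (suc n) f = f n ∧ all< n f

all<-sound : ∀ n (f : ℕ → Bool) → all< n f ≡ true → ∀ i → i < n → f i ≡ true
all<-sound (suc n) f h i (s≤s i≤n) with f n in fₙ | m≤n⇒m<n∨m≡n i≤n
... | true | inj₁ i<n  = all<-sound n f h i i<n
... | true | inj₂ refl = fₙ

∧-true : ∀ a {b} → a ∧ b ≡ true → a ≡ true × b ≡ true
∧-true true eq = refl , eq

≤ᵇ-true : ∀ {m n} → (m ≤ᵇ n) ≡ true → m ≤ n
≤ᵇ-true {m} {n} eq = ≤ᵇ⇒≤ m n (subst T (sym eq) tt)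

<ᵇ-true : ∀ {m n} → (m <ᵇ n) ≡ true → m < n
<ᵇ-true {m} {n} eq = <ᵇ⇒< m n (subst T (sym eq) tt)

-- The soundness lemmas of the checks take an arbitrary table, so that only the closing proofs by refl evaluate one.
record IsTable (tab : List (List Triple)) (k l : ℕ) : Set where
  field
    cell-≡ : ∀ {m n} → m ≤ k → n < l → cell tab m n ≡ cs m n

  qFrom-≡ : ∀ {m n} → m ≤ k → n < l → qFrom tab m n ≡ q m n
  qFrom-≡ m≤k n<l = cong norm (cell-≡ m≤k n<l)
open IsTable

table-isTable : ∀ l k → IsTable (table l k) k l
table-isTable l k = record { cell-≡ = cell-correct l k }

-- `Small` at level `2 + m`, for `x = 9 + i` and `y = 56 + j`. Both windows have length `2 + m`, the
-- step of the recursion at that level.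
windowTest : List (List Triple) → ℕ → ℕ → ℕ → Bool
windowTest tab m i j =
  10 * qFrom tab (2 + m) (6 + ((9 + i) + (56 + j))) ≤ᵇ 3 * (qFrom tab (2 + m) (9 + i) * qFrom tab (2 + m) (56 + j))

windowRow : List (List Triple) → ℕ → Bool
windowRow tab m = all< (2 + m) λ i → all< (2 + m) (windowTest tab m i)

windowCheck : List (List Triple) → Bool
windowCheck tab = all< 22 (windowRow tab)

window-sound : ∀ {tab} → IsTable tab 23 120 → windowCheck tab ≡ true → ∀ m i j → m < 22 → i < 2 + m → j < 2 + m →
  10 * q (2 + m) (6 + ((9 + i) + (56 + j))) ≤ 3 * (q (2 + m) (9 + i) * q (2 + m) (56 + j))
window-sound {tab} tab-ok ok m i j m<22 i<m j<m = subst₂ _≤_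
  -- As `i` and `j` are at most 22, the largest argument is 6 + 31 + 78 = 115.
  (cong (10 *_) (qFrom-≡ tab-ok m≤23 (<-≤-trans (s≤s (+-monoʳ-≤ 6 (+-mono-≤ (+-monoʳ-≤ 9 i≤22) (+-monoʳ-≤ 56 j≤22)))) (≤ᵇ⇒≤ 116 120 tt))))
  (cong (3 *_) (cong₂ _*_ (qFrom-≡ tab-ok m≤23 (<-≤-trans (s≤s (+-monoʳ-≤ 9 i≤22)) (≤ᵇ⇒≤ 32 120 tt)))
                          (qFrom-≡ tab-ok m≤23 (<-≤-trans (s≤s (+-monoʳ-≤ 56 j≤22)) (≤ᵇ⇒≤ 79 120 tt)))))
  (≤ᵇ-true (all<-sound (2 + m) (windowTest tab m i)
    (all<-sound (2 + m) (λ i → all< (2 + m) (windowTest tab m i)) (all<-sound 22 (windowRow tab) ok m m<22) i i<m) j j<m))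
  where
  m≤23 : 2 + m ≤ 23
  m≤23 = s≤s m<22
  i≤22 : i ≤ 22
  i≤22 = ≤-pred (≤-trans i<m m≤23)
  j≤22 : j ≤ 22
  j≤22 = ≤-pred (≤-trans j<m m≤23)

-- Level 244 on the left and 23 on the right make one test serve all levels from 23 on: 244 = 6 +
-- 119 + 119 is the largest argument, so level 244 counts all partitions.
finiteTest : List (List Triple) → ℕ → ℕ → Bool
finiteTest tab i j =
  3 * qFrom tab 244 (6 + ((9 + j) + (56 + i))) <ᵇ qFrom tab 23 (9 + j) * qFrom tab 23 (56 + i)

-- With `y = 56 + i` and `x = 9 + j` the ranges say `y < 120` and `x ≤ y`.
finiteCheck : List (List Triple) → Bool
finiteCheck tab = all< 64 λ i → all< (48 + i) (finiteTest tab i)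

finite-sound : ∀ {tab} → IsTable tab 244 245 → finiteCheck tab ≡ true → ∀ i j → i < 64 → j < 48 + i →
  3 * q 244 (6 + ((9 + j) + (56 + i))) < q 23 (9 + j) * q 23 (56 + i)
finite-sound {tab} tab-ok ok i j i<64 j<48+i = subst₂ _<_
  (cong (3 *_) (qFrom-≡ tab-ok ≤-refl (s≤s (≤-trans (+-monoʳ-≤ 6 (+-mono-≤ j≤119 i≤119)) (≤ᵇ⇒≤ 244 244 tt)))))
  (cong₂ _*_ (qFrom-≡ tab-ok (≤ᵇ⇒≤ 23 244 tt) (s≤s (≤-trans j≤119 (≤ᵇ⇒≤ 119 244 tt))))
             (qFrom-≡ tab-ok (≤ᵇ⇒≤ 23 244 tt) (s≤s (≤-trans i≤119 (≤ᵇ⇒≤ 119 244 tt)))))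
  (<ᵇ-true (all<-sound (48 + i) (finiteTest tab i) (all<-sound 64 (λ i → all< (48 + i) (finiteTest tab i)) ok i i<64) j j<48+i))
  where
  i≤63 : i ≤ 63
  i≤63 = ≤-pred i<64
  i≤119 : 56 + i ≤ 119
  i≤119 = +-monoʳ-≤ 56 i≤63
  j≤119 : 9 + j ≤ 119
  j≤119 = +-monoʳ-≤ 9 (≤-pred (≤-trans j<48+i (+-monoʳ-≤ 48 i≤63)))

growthTest : List (List Triple) → ℕ → Bool
growthTest tab i = 10 * ((62 + (120 + i)) * qFrom tab 56 56) <ᵇ qFrom tab 23 (120 + i)

growthCheck : List (List Triple) → Bool
growthCheck tab = (10 * (23 * qFrom tab 56 56) ≤ᵇ qFrom tab 22 120) ∧ all< 23 (growthTest tab)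

growth-sound : ∀ {tab} → IsTable tab 56 143 → growthCheck tab ≡ true →
  10 * (23 * q 56 56) ≤ q 22 120 ×
  (∀ i → i < 23 → 10 * ((62 + (120 + i)) * q 56 56) < q 23 (120 + i))
growth-sound {tab} tab-ok ok =
  subst₂ _≤_ (cong (λ s → 10 * (23 * s)) q₅₆)
             (qFrom-≡ tab-ok (≤ᵇ⇒≤ 22 56 tt) (≤ᵇ⇒≤ 121 143 tt))
             (≤ᵇ-true (proj₁ (∧-true (10 * (23 * qFrom tab 56 56) ≤ᵇ qFrom tab 22 120) ok))) ,
  λ i i<23 → subst₂ _<_ (cong (λ s → 10 * ((62 + (120 + i)) * s)) q₅₆)
             (qFrom-≡ tab-ok (≤ᵇ⇒≤ 23 56 tt) (+-monoʳ-< 120 i<23))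
             (<ᵇ-true (all<-sound 23 (growthTest tab) (proj₂ (∧-true (10 * (23 * qFrom tab 56 56) ≤ᵇ qFrom tab 22 120) ok)) i i<23))
  where
  q₅₆ : qFrom tab 56 56 ≡ q 56 56
  q₅₆ = qFrom-≡ tab-ok ≤-refl (≤ᵇ⇒≤ 57 143 tt)

-- Sealed, so that no later use evaluates the tables again.
abstract
  window : ∀ m i j → m < 22 → i < 2 + m → j < 2 + m →
    10 * q (2 + m) (6 + ((9 + i) + (56 + j))) ≤ 3 * (q (2 + m) (9 + i) * q (2 + m) (56 + j))
  window = window-sound (table-isTable 120 23) refl

  finite : ∀ i j → i < 64 → j < 48 + i →
    3 * q 244 (6 + ((9 + j) + (56 + i))) < q 23 (9 + j) * q 23 (56 + i)
  finite = finite-sound (table-isTable 245 244) refl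

  growth-base : 10 * (23 * q 56 56) ≤ q 22 120 ×
    (∀ i → i < 23 → 10 * ((62 + (120 + i)) * q 56 56) < q 23 (120 + i))
  growth-base = growth-sound (table-isTable 143 56) refl

-- The factor 10/3 up to level 23

combine : ∀ A B u u′ X X′ Y → A * u ≤ B * (X * Y) → A * u′ ≤ B * (X′ * Y) → A * (u + u′) ≤ B * ((X + X′) * Y)
combine A B u u′ X X′ Y h h′ = begin
  A * (u + u′)                    ≡⟨ *-distribˡ-+ A u u′ ⟩
  A * u + A * u′                  ≤⟨ +-mono-≤ h h′ ⟩
  B * (X * Y) + B * (X′ * Y)      ≡⟨ *-distribˡ-+ B (X * Y) (X′ * Y) ⟨
  B * (X * Y + X′ * Y)            ≡⟨ cong (B *_) (*-distribʳ-+ Y X X′) ⟨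
  B * ((X + X′) * Y)              ∎
  where open ≤-Reasoning

shiftʳ : ∀ k x y → 6 + (x + (k + y)) ≡ k + (6 + (x + y))
shiftʳ = solve-∀

shiftˡ : ∀ k x y → 6 + ((k + x) + y) ≡ k + (6 + (x + y))
shiftˡ = solve-∀

Small : ℕ → ℕ → ℕ → Set
Small m x y = 10 * q m (6 + (x + y)) ≤ 3 * (q m x * q m y)

-- `q-step` splits the left side and the factor at `suc m + x`, while `q (suc m) y` is common to
-- both summands; hence the mixed levels in the first hypothesis.
small-stepˡ : ∀ m x y → 10 * q m (6 + ((suc m + x) + y)) ≤ 3 * (q m (suc m + x) * q (suc m) y) →
  Small (suc m) x y → Small (suc m) (suc m + x) y
small-stepˡ m x y h h′ = subst₂ _≤_
  (cong (10 *_) (sym (trans (cong (q (suc m)) (shiftˡ (suc m) x y))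
    (trans (q-step m _) (cong (λ i → q m i + q (suc m) (6 + (x + y))) (sym (shiftˡ (suc m) x y)))))))
  (cong (λ s → 3 * (s * q (suc m) y)) (sym (q-step m x)))
  (combine 10 3 (q m (6 + ((suc m + x) + y))) (q (suc m) (6 + (x + y))) (q m (suc m + x)) (q (suc m) x) (q (suc m) y) h h′)

small-sym : ∀ m x y → Small m x y → Small m y x
small-sym m x y = subst₂ _≤_ (cong (λ s → 10 * q m (6 + s)) (+-comm x y)) (cong (3 *_) (*-comm (q m x) (q m y)))

-- Induction on the level `2 + m`, then on `x` and `y`: the table covers the windows, and beyond
-- them one argument is lowered by the level.
small : ∀ m → m ≤ 21 → ∀ x y → 9 ≤ x → 56 ≤ y → Small (2 + m) x y
small m m≤21 x y 9≤x 56≤y =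
  window-induction (λ x → Small (2 + m) x y) 9 (suc m)
    (λ i i<m → window-induction (λ y → Small (2 + m) (9 + i) y) 56 (suc m)
      (λ j j<m → window m i j (s≤s m≤21) i<m j<m)
      -- Lowering `y` is lowering the left argument after a swap, so `prev` must accept both orders
      -- of the bounds 9 and 56.
      (λ y 56≤y ih → small-sym (2 + m) _ _ (small-stepˡ (suc m) y (9 + i)
        (prev m m≤21 (2 + m + y) (9 + i) (inj₂ (≤-trans 56≤y (m≤n+m y (2 + m)) , m≤m+n 9 i)))
        (small-sym (2 + m) _ _ ih)))
      y 56≤y)
    (λ x 9≤x ih → small-stepˡ (suc m) x y
      (prev m m≤21 (2 + m + x) y (inj₁ (≤-trans 9≤x (m≤n+m x (2 + m)) , 56≤y))) ih)
    x 9≤x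
  where
  -- `Small` fails at level 1, where every value is 1. The mixed inequality below level 2 survives
  -- because its second factor is at least 4, and 10 ≤ 3 · 4.
  two : ∀ {y} → 9 ≤ y → 4 ≤ q 2 y
  two 9≤y = ≤-trans (≤-trans (≤-reflexive (sym q₂₆)) (q-mono-n 1 (≤ᵇ⇒≤ 6 9 tt))) (q-mono-n 1 9≤y)
    where
    q₂₆ : q 2 6 ≡ 4
    q₂₆ = trans (q-step 1 4) (cong₂ _+_ (q-one 6) (trans (q-step 1 2) (cong₂ _+_ (q-one 4)
            (trans (q-step 1 0) (cong₂ _+_ (q-one 2) (q-zero 2))))))
  prev : ∀ m → m ≤ 21 → ∀ x y → (9 ≤ x × 56 ≤ y) ⊎ (56 ≤ x × 9 ≤ y) →
    10 * q (suc m) (6 + (x + y)) ≤ 3 * (q (suc m) x * q (2 + m) y)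
  prev zero _ x y h = begin
    10 * q 1 (6 + (x + y))     ≡⟨ cong (10 *_) (q-one (6 + (x + y))) ⟩
    10                         ≤⟨ ≤ᵇ⇒≤ 10 12 tt ⟩
    3 * (1 * 4)                ≤⟨ *-monoʳ-≤ 3 (*-mono-≤ (≤-reflexive (sym (q-one x))) (two (9≤y h))) ⟩
    3 * (q 1 x * q 2 y)        ∎
    where
    open ≤-Reasoning
    9≤y : (9 ≤ x × 56 ≤ y) ⊎ (56 ≤ x × 9 ≤ y) → 9 ≤ y
    9≤y (inj₁ (_ , 56≤y)) = ≤-trans (≤ᵇ⇒≤ 9 56 tt) 56≤y
    9≤y (inj₂ (_ , 9≤y))  = 9≤y
  prev (suc m) m<21 x y h = ≤-trans (known h) (*-monoʳ-≤ 3 (*-monoʳ-≤ (q (2 + m) x) (q-mono-suc (2 + m) y)))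
    where
    known : (9 ≤ x × 56 ≤ y) ⊎ (56 ≤ x × 9 ≤ y) → Small (2 + m) x y
    known (inj₁ (9≤x , 56≤y)) = small m (<⇒≤ m<21) x y 9≤x 56≤y
    known (inj₂ (56≤x , 9≤y)) = small-sym (2 + m) y x (small m (<⇒≤ m<21) y x 9≤y 56≤x)

-- From `y` to `23 + y` the left side grows by the constant `10 * (23 * q 56 56)`, the right side by
-- `q 22 (23 + y)`, which is at least `q 22 120`.
growth : ∀ y → 120 ≤ y → 10 * ((62 + y) * q 56 56) < q 23 y
growth = window-induction (λ y → 10 * ((62 + y) * q 56 56) < q 23 y) 120 22 (proj₂ growth-base) step
  where
  distrib : ∀ s y p → 10 * ((62 + (s + y)) * p) ≡ 10 * (s * p) + 10 * ((62 + y) * p)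
  distrib = solve-∀
  step : ∀ y → 120 ≤ y → 10 * ((62 + y) * q 56 56) < q 23 y → 10 * ((62 + (23 + y)) * q 56 56) < q 23 (23 + y)
  step y 120≤y ih = subst₂ _<_ (sym (distrib 23 y (q 56 56))) (sym (q-step 22 y))
    (+-mono-≤-< (≤-trans (proj₁ growth-base) (q-mono-n 21 (≤-trans 120≤y (m≤n+m y 23)))) ih)

-- The factor 3 at all levels from 23 on

Super : ℕ → ℕ → ℕ → Set
Super m x y = 3 * q m (6 + (x + y)) < q m x * q m y

-- Keeps, at every level m ≥ 23, the surplus that level 23 has over the factor 3.
Surplus : ℕ → ℕ → ℕ → Set
Surplus m x y = 30 * q m (6 + (x + y)) + q m x * q 23 y ≤ 10 * (q m x * q m y)

-- Raising `X` by `d` adds `d * g` on the left and the larger `10 * (d * Y)` on the right.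
surplus-scale : ∀ {u X X′ Y g} → X ≤ X′ → g ≤ Y → 30 * u + X * g ≤ 10 * (X * Y) → 30 * u + X′ * g ≤ 10 * (X′ * Y)
surplus-scale {u} {X} {X′} {Y} {g} X≤X′ g≤Y h = subst (λ X′ → 30 * u + X′ * g ≤ 10 * (X′ * Y)) (m+[n∸m]≡n X≤X′) (begin
  30 * u + (X + d) * g            ≡⟨ split u X d g ⟩
  (30 * u + X * g) + d * g        ≤⟨ +-mono-≤ h (≤-trans (*-monoʳ-≤ d g≤Y) (m≤m+n _ _)) ⟩
  10 * (X * Y) + (d * Y + 9 * (d * Y)) ≡⟨ join X d Y ⟩
  10 * ((X + d) * Y)              ∎)
  where
  open ≤-Reasoning
  d = X′ ∸ X
  split : ∀ u X d g → 30 * u + (X + d) * g ≡ (30 * u + X * g) + d * g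
  split = solve-∀
  join : ∀ X d Y → 10 * (X * Y) + (d * Y + 9 * (d * Y)) ≡ 10 * ((X + d) * Y)
  join = solve-∀

-- Tripling `Small` uses nine of the ten products; the tenth is the surplus.
small⇒surplus : ∀ x y → Small 23 x y → Surplus 23 x y
small⇒surplus x y h = begin
  30 * q 23 (6 + (x + y)) + X * Y     ≡⟨ cong (λ s → s + X * Y) (*-assoc 3 10 (q 23 (6 + (x + y)))) ⟩
  3 * (10 * q 23 (6 + (x + y))) + X * Y  ≤⟨ +-monoˡ-≤ (X * Y) (*-monoʳ-≤ 3 h) ⟩
  3 * (3 * (X * Y)) + X * Y           ≡⟨ join (X * Y) ⟩
  10 * (X * Y)                        ∎
  where
  open ≤-Reasoning
  X = q 23 x
  Y = q 23 y
  join : ∀ s → 3 * (3 * s) + s ≡ 10 * s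
  join = solve-∀

-- The summand that `q-step` adds on the left is paid by `Super` at the smaller `y`, so the surplus
-- is carried on undiminished.
surplus-step : ∀ m x y → 23 ≤ m → Surplus m x (suc m + y) → Super (suc m) x y → Surplus (suc m) x (suc m + y)
surplus-step m x y 23≤m h h′ = begin
  30 * q (suc m) (6 + (x + (suc m + y))) + X * g   ≡⟨ cong (λ s → 30 * s + X * g) (trans (cong (q (suc m)) (shiftʳ (suc m) x y))
                                                      (trans (q-step m _) (cong (λ i → q m i + u′) (sym (shiftʳ (suc m) x y))))) ⟩
  30 * (u + u′) + X * g                            ≡⟨ split u u′ (X * g) ⟩
  (30 * u + X * g) + 10 * (3 * u′)                 ≤⟨ +-mono-≤ (surplus-scale {u} {q m x} {X} (q-mono-suc m x) (q-mono-m 23≤m (suc m + y)) h)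
                                                               (*-monoʳ-≤ 10 (<⇒≤ h′)) ⟩
  10 * (X * q m (suc m + y)) + 10 * (X * q (suc m) y) ≡⟨ join X (q m (suc m + y)) (q (suc m) y) ⟩
  10 * (X * (q m (suc m + y) + q (suc m) y))       ≡⟨ cong (λ s → 10 * (X * s)) (q-step m y) ⟨
  10 * (X * q (suc m) (suc m + y))                 ∎
  where
  open ≤-Reasoning
  X = q (suc m) x
  g = q 23 (suc m + y)
  u = q m (6 + (x + (suc m + y)))
  u′ = q (suc m) (6 + (x + y))
  split : ∀ u u′ s → 30 * (u + u′) + s ≡ (30 * u + s) + 10 * (3 * u′)
  split = solve-∀
  join : ∀ X a b → 10 * (X * a) + 10 * (X * b) ≡ 10 * (X * (a + b))
  join = solve-∀

-- Each level above m₀ adds the partitions whose largest part exceeds m₀, and such a part leaves at most w.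
q-above : ∀ m₀ w d → q (d + m₀) (m₀ + w) ≤ q m₀ (m₀ + w) + d * q (d + m₀) w
q-above m₀ w zero    = m≤m+n _ _
q-above m₀ w (suc d) with m₀ + w ≤? d + m₀
... | yes z≤m = begin
  q (suc d + m₀) (m₀ + w)                         ≡⟨ q-saturate-suc z≤m ⟩
  q (d + m₀) (m₀ + w)                             ≤⟨ q-above m₀ w d ⟩
  q m₀ (m₀ + w) + d * q (d + m₀) w                ≤⟨ +-monoʳ-≤ _ (*-mono-≤ (n≤1+n d) (q-mono-suc (d + m₀) w)) ⟩
  q m₀ (m₀ + w) + suc d * q (suc d + m₀) w        ∎
  where open ≤-Reasoning
... | no z≰m = begin
  q (suc d + m₀) (m₀ + w)                         ≡⟨ cong (q (suc d + m₀)) (m+[n∸m]≡n m<z) ⟨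
  q (suc d + m₀) (suc d + m₀ + j)                 ≡⟨ q-step (d + m₀) j ⟩
  q (d + m₀) (suc d + m₀ + j) + q (suc d + m₀) j  ≡⟨ cong (λ i → q (d + m₀) i + q (suc d + m₀) j) (m+[n∸m]≡n m<z) ⟩
  q (d + m₀) (m₀ + w) + q (suc d + m₀) j          ≤⟨ +-mono-≤ (q-above m₀ w d) (q-mono-n (d + m₀) j≤w) ⟩
  (q m₀ (m₀ + w) + d * q (d + m₀) w) + Q          ≤⟨ +-monoˡ-≤ Q (+-monoʳ-≤ (q m₀ (m₀ + w)) (*-monoʳ-≤ d (q-mono-suc (d + m₀) w))) ⟩
  (q m₀ (m₀ + w) + d * Q) + Q                     ≡⟨ +-assoc (q m₀ (m₀ + w)) (d * Q) Q ⟩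
  q m₀ (m₀ + w) + (d * Q + Q)                     ≡⟨ cong (_+_ (q m₀ (m₀ + w))) (+-comm (d * Q) Q) ⟩
  q m₀ (m₀ + w) + suc d * Q                       ∎
  where
  open ≤-Reasoning
  Q = q (suc d + m₀) w
  m<z : suc d + m₀ ≤ m₀ + w
  m<z = ≰⇒> z≰m
  j = (m₀ + w) ∸ (suc d + m₀)
  j≤w : j ≤ w
  j≤w = ≤-trans (∸-monoʳ-≤ (m₀ + w) (m≤n+m m₀ (suc d))) (≤-reflexive (m+n∸m≡n m₀ w))

-- Only the `w` levels just above `m₀` can contribute, since from level `m₀ + w` on the value is
-- constant.
q-above-all : ∀ {m₀ m} w → m₀ ≤ m → q m (m₀ + w) ≤ q m₀ (m₀ + w) + w * q m w
q-above-all {m₀} {m} w m₀≤m with m ∸ m₀ ≤? w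
... | yes d≤w = begin
  q m (m₀ + w)                                 ≡⟨ cong (λ i → q i (m₀ + w)) (m∸n+n≡m m₀≤m) ⟨
  q (m ∸ m₀ + m₀) (m₀ + w)                     ≤⟨ q-above m₀ w (m ∸ m₀) ⟩
  q m₀ (m₀ + w) + (m ∸ m₀) * q (m ∸ m₀ + m₀) w ≡⟨ cong (λ i → q m₀ (m₀ + w) + (m ∸ m₀) * q i w) (m∸n+n≡m m₀≤m) ⟩
  q m₀ (m₀ + w) + (m ∸ m₀) * q m w             ≤⟨ +-monoʳ-≤ _ (*-monoˡ-≤ (q m w) d≤w) ⟩
  q m₀ (m₀ + w) + w * q m w                    ∎
  where open ≤-Reasoning
... | no d≰w = begin
  q m (m₀ + w)                                 ≤⟨ q≤q m (≤-reflexive (+-comm m₀ w)) ⟩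
  q (w + m₀) (m₀ + w)                          ≤⟨ q-above m₀ w w ⟩
  q m₀ (m₀ + w) + w * q (w + m₀) w             ≤⟨ +-monoʳ-≤ _ (*-monoʳ-≤ w (q-mono-m w+m₀≤m w)) ⟩
  q m₀ (m₀ + w) + w * q m w                    ∎
  where
  open ≤-Reasoning
  w+m₀≤m : w + m₀ ≤ m
  w+m₀≤m = ≤-trans (+-monoˡ-≤ m₀ (<⇒≤ (≰⇒> d≰w))) (≤-reflexive (m∸n+n≡m m₀≤m))

SuperBelow : ℕ → Set
SuperBelow b = ∀ m x y → x + y < b → 23 ≤ m → 9 ≤ x → 56 ≤ y → Super m x y

-- Climbs from level 23 one level at a time; the bound on `y` keeps the lowered argument at 56 or
-- more, where the induction hypothesis applies.
surplus : ∀ x y → SuperBelow (x + y) → 9 ≤ x → ∀ d → 56 + (d + 23) ≤ y → Surplus (d + 23) x y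
surplus x y ih 9≤x zero    m≤y = small⇒surplus x y (small 21 ≤-refl x y 9≤x (≤-trans (m≤m+n 56 23) m≤y))
surplus x y ih 9≤x (suc d) m≤y = subst (Surplus (suc m) x) y′-eq
  (surplus-step m x y′ (m≤n+m 23 d) (subst (Surplus m x) (sym y′-eq) (surplus x y ih 9≤x d (≤-trans (+-monoʳ-≤ 56 (n≤1+n m)) m≤y)))
    (ih (suc m) x y′ (+-monoʳ-< x (subst (y′ <_) y′-eq (m<n+m y′ z<s))) (≤-trans (m≤n+m 23 d) (n≤1+n m)) 9≤x 56≤y′))
  where
  m = d + 23
  y′ = y ∸ suc m
  56≤y′ : 56 ≤ y′
  56≤y′ = subst (_≤ y′) (m+n∸n≡m 56 (suc m)) (∸-monoˡ-≤ (suc m) m≤y)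
  y′-eq : suc m + y′ ≡ y
  y′-eq = m+[n∸m]≡n (≤-trans (m≤n+m (suc m) 56) m≤y)

finite-super : ∀ m x y → 23 ≤ m → 9 ≤ x → 56 ≤ y → x ≤ y → y < 120 → Super m x y
finite-super m x y 23≤m 9≤x 56≤y x≤y y<120 = begin-strict
  3 * q m (6 + (x + y))    ≤⟨ *-monoʳ-≤ 3 (q≤q m (+-monoʳ-≤ 6 (+-mono-≤ (≤-trans x≤y (≤-pred y<120)) (≤-pred y<120)))) ⟩
  3 * q 244 (6 + (x + y))  <⟨ subst₂ (λ x y → 3 * q 244 (6 + (x + y)) < q 23 x * q 23 y) x-eq y-eq (finite i j i<64 j<48+i) ⟩
  q 23 x * q 23 y          ≤⟨ *-mono-≤ (q-mono-m 23≤m x) (q-mono-m 23≤m y) ⟩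
  q m x * q m y            ∎
  where
  open ≤-Reasoning
  i = y ∸ 56
  j = x ∸ 9
  x-eq : 9 + j ≡ x
  x-eq = m+[n∸m]≡n 9≤x
  y-eq : 56 + i ≡ y
  y-eq = m+[n∸m]≡n 56≤y
  i<64 : i < 64
  i<64 = +-cancelˡ-< 56 i 64 (subst (_< 120) (sym y-eq) y<120)
  j<48+i : j < 48 + i
  j<48+i = +-cancelˡ-≤ 9 (suc j) (48 + i) (s≤s (subst₂ _≤_ (sym x-eq) (sym y-eq) x≤y))

super-≤ : ∀ m x y → SuperBelow (x + y) → 23 ≤ m → 9 ≤ x → 56 ≤ y → x ≤ y → Super m x y
super-≤ m x y ih 23≤m 9≤x 56≤y x≤y with y <? 120
... | yes y<120 = finite-super m x y 23≤m 9≤x 56≤y x≤y y<120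
... | no  y≮120 = *-cancelˡ-< 10 _ _ (subst (_< 10 * (X * q m y)) (*-assoc 10 3 (q m z)) final)
  where
  open ≤-Reasoning
  z = 6 + (x + y)
  X = q m x
  -- The last level that `surplus` reaches; `w` below is `z − m₀`.
  m₀ = y ∸ 56
  w = 6 + (x + 56)
  120≤y : 120 ≤ y
  120≤y = ≮⇒≥ y≮120
  m₀-eq : 56 + m₀ ≡ y
  m₀-eq = m+[n∸m]≡n 56≤y
  X-pos : 0 < X
  X-pos = subst (λ i → 0 < q i x) (m+[n∸m]≡n (≤-trans (s≤s z≤n) 23≤m)) (q-pos (m ∸ 1) x)
  surplus-at : ∀ k → 23 ≤ k → 56 + k ≤ y → Surplus k x y
  surplus-at k 23≤k k≤y = subst (λ k → Surplus k x y) (m∸n+n≡m 23≤k)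
    (surplus x y ih 9≤x (k ∸ 23) (≤-trans (+-monoʳ-≤ 56 (≤-reflexive (m∸n+n≡m 23≤k))) k≤y))
  final : 30 * q m z < 10 * (X * q m y)
  final with m ≤? m₀
  ... | yes m≤m₀ = begin-strict
    -- Here the surplus serves only to make the inequality strict.
    30 * q m z                    <⟨ m<m+n (30 * q m z) (*-mono-< X-pos (≤-<-trans z≤n (growth y 120≤y))) ⟩
    30 * q m z + X * q 23 y       ≤⟨ surplus-at m 23≤m (≤-trans (+-monoʳ-≤ 56 m≤m₀) (≤-reflexive m₀-eq)) ⟩
    10 * (X * q m y)              ∎
  -- `X * q 23 y` is added to both sides: on the left it completes `Surplus` at level `m₀`, on the
  -- right it pays for the levels above.
  ... | no m≰m₀ = +-cancelʳ-< (X * q 23 y) (30 * q m z) (10 * (X * q m y)) (begin-strict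
    30 * q m z + X * q 23 y                               ≤⟨ +-monoˡ-≤ (X * q 23 y) (*-monoʳ-≤ 30 above) ⟩
    30 * (q m₀ z + w * q m w) + X * q 23 y                ≡⟨ regroup (q m₀ z) w (q m w) (X * q 23 y) ⟩
    (30 * q m₀ z + X * q 23 y) + 10 * (w * (3 * q m w))   ≤⟨ +-mono-≤
        (surplus-scale {q m₀ z} (q-mono-m m₀≤m x) (q-mono-m 23≤m₀ y) (surplus-at m₀ 23≤m₀ (≤-reflexive m₀-eq)))
        -- Since `w = 6 + (x + 56)`, this is the induction hypothesis at `(x, 56)`, a smaller sum
        -- because `y ≥ 120`.
        (*-monoʳ-≤ 10 (*-monoʳ-≤ w (≤-trans (<⇒≤ (ih m x 56 (+-monoʳ-< x (<-≤-trans (≤ᵇ⇒≤ 57 120 tt) 120≤y)) 23≤m 9≤x ≤-refl))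
                                            (*-monoʳ-≤ X (q≤q m ≤-refl))))) ⟩
    10 * (X * q m₀ y) + 10 * (w * (X * q 56 56))          ≤⟨ +-mono-≤ (*-monoʳ-≤ 10 (*-monoʳ-≤ X (q-mono-m m₀≤m y)))
                                                                      (*-monoʳ-≤ 10 (*-monoˡ-≤ (X * q 56 56) w≤62+y)) ⟩
    10 * (X * q m y) + 10 * ((62 + y) * (X * q 56 56))    ≡⟨ cong (λ s → 10 * (X * q m y) + s) (pull (62 + y) X (q 56 56)) ⟩
    10 * (X * q m y) + X * (10 * ((62 + y) * q 56 56))    <⟨ +-monoʳ-< (10 * (X * q m y)) (*-monoʳ-< X ⦃ >-nonZero X-pos ⦄ (growth y 120≤y)) ⟩
    10 * (X * q m y) + X * q 23 y                         ∎)
    where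
    m₀≤m : m₀ ≤ m
    m₀≤m = <⇒≤ (≰⇒> m≰m₀)
    23≤m₀ : 23 ≤ m₀
    23≤m₀ = ≤-trans (≤ᵇ⇒≤ 23 64 tt) (∸-monoˡ-≤ 56 120≤y)
    z-eq : m₀ + w ≡ z
    z-eq = trans (move m₀ x 56) (cong (λ s → 6 + (x + s)) m₀-eq)
      where
      move : ∀ a x b → a + (6 + (x + b)) ≡ 6 + (x + (b + a))
      move = solve-∀
    above : q m z ≤ q m₀ z + w * q m w
    above = subst (λ i → q m i ≤ q m₀ i + w * q m w) z-eq (q-above-all w m₀≤m)
    w≤62+y : w ≤ 62 + y
    w≤62+y = ≤-trans (≤-reflexive (cong (_+_ 6) (+-comm x 56))) (+-monoʳ-≤ 62 x≤y)
    regroup : ∀ a w b s → 30 * (a + w * b) + s ≡ (30 * a + s) + 10 * (w * (3 * b))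
    regroup = solve-∀
    pull : ∀ k X p → 10 * (k * (X * p)) ≡ X * (10 * (k * p))
    pull = solve-∀

superBelow : ∀ b → SuperBelow b
superBelow (suc b) m x y (s≤s x+y≤b) 23≤m 9≤x 56≤y with ≤-total x y
... | inj₁ x≤y = super-≤ m x y (λ m x′ y′ lt → superBelow b m x′ y′ (<-≤-trans lt x+y≤b)) 23≤m 9≤x 56≤y x≤y
-- The swap is allowed because both arguments are at least 56 here.
... | inj₂ y≤x = subst₂ _<_ (cong (λ s → 3 * q m (6 + s)) (+-comm y x)) (*-comm (q m y) (q m x))
  (super-≤ m y x (λ m x′ y′ lt → superBelow b m x′ y′ (<-≤-trans lt (subst (_≤ b) (+-comm x y) x+y≤b)))
    23≤m (≤-trans (≤ᵇ⇒≤ 9 56 tt) 56≤y) (≤-trans 56≤y y≤x) y≤x)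

partition-super : ∀ x y → 9 ≤ x → 56 ≤ y → 3 * q (6 + (x + y)) (6 + (x + y)) < q x x * q y y
partition-super x y 9≤x 56≤y = <-≤-trans
  (superBelow (suc (x + y)) (6 + (x + y)) x y ≤-refl
    (≤-trans (≤ᵇ⇒≤ 23 56 tt) (≤-trans 56≤y (≤-trans (m≤n+m y x) (m≤n+m (x + y) 6)))) 9≤x 56≤y)
  (*-mono-≤ (q≤q _ ≤-refl) (q≤q _ ≤-refl))

-- Return to ranks

entry-cs : ∀ m n t → entry (cs m n) t ≡ c m n t
entry-cs m n 0 = refl
entry-cs m n 1 = refl
entry-cs m n 2 = refl
entry-cs m n (suc (suc (suc t))) = trans (entry-cs m n t) (sym (c-periodic m n t))

RFrom : List (List Triple) → ℕ → ℕ → ℕ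
RFrom tab r n = Σ< n (λ k → entry (cell tab (suc k) (n ∸ suc k)) (k + r * 2))

RFrom-≡ : ∀ {tab l} → IsTable tab l l → ∀ r {n} → n ≤ l → RFrom tab r n ≡ R r n
RFrom-≡ tab-ok r {n} n≤l = Σ<-cong n (λ k k<n → trans
  (cong (λ x → entry x (k + r * 2)) (cell-≡ tab-ok (≤-trans k<n n≤l) (<-≤-trans (∸-monoʳ-< {n} {suc k} {0} z<s k<n) n≤l)))
  (entry-cs (suc k) (n ∸ suc k) (k + r * 2)))

rankTest : List ℕ → ℕ → ℕ → Bool
rankTest vs a b = nth 0 vs (a + b) <ᵇ nth 0 vs a * nth 0 vs b

-- The pairs with `lo ≤ b ≤ a < 58`. From `a = 58 = 56 + 2` on, `R-super-large` takes over; sums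
-- reach 57 + 57 = 114, so 115 values suffice.
rankCheck : ℕ → List ℕ → Bool
rankCheck lo vs = all< (58 ∸ lo) λ i → all< (suc i) λ j → rankTest vs (lo + i) (lo + j)

rank-sound : ∀ {tab l} → IsTable tab l l → 115 ≤ l → ∀ r lo → rankCheck lo (applyUpTo (RFrom tab r) 115) ≡ true →
  ∀ a b → lo ≤ b → b ≤ a → a < 58 → R r (a + b) < R r a * R r b
rank-sound {tab} {l} tab-ok 115≤l r lo ok a b lo≤b b≤a a<58 = subst₂ _<_
  (value (s≤s (≤-trans (+-mono-≤ a≤57 b≤57) (≤ᵇ⇒≤ 114 114 tt))))
  (cong₂ _*_ (value (≤-<-trans a≤57 (≤ᵇ⇒≤ 58 115 tt))) (value (≤-<-trans b≤57 (≤ᵇ⇒≤ 58 115 tt))))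
  (<ᵇ-true (subst₂ (λ a b → rankTest vs a b ≡ true) (m+[n∸m]≡n lo≤a) (m+[n∸m]≡n lo≤b)
    (all<-sound (suc (a ∸ lo)) (λ j → rankTest vs (lo + (a ∸ lo)) (lo + j))
      (all<-sound (58 ∸ lo) (λ i → all< (suc i) λ j → rankTest vs (lo + i) (lo + j)) ok (a ∸ lo) (∸-monoˡ-< a<58 lo≤a))
      (b ∸ lo) (s≤s (∸-monoˡ-≤ lo b≤a)))))
  where
  vs = applyUpTo (RFrom tab r) 115
  lo≤a : lo ≤ a
  lo≤a = ≤-trans lo≤b b≤a
  a≤57 : a ≤ 57
  a≤57 = ≤-pred a<58
  b≤57 : b ≤ 57
  b≤57 = ≤-trans b≤a a≤57
  value : ∀ {n} → n < 115 → nth 0 vs n ≡ R r n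
  value n<115 = trans (nth-applyUpTo 0 (RFrom tab r) n<115) (RFrom-≡ tab-ok r (≤-trans (<⇒≤ n<115) 115≤l))

FiniteRange : ℕ → ℕ → Set
FiniteRange r lo = ∀ a b → lo ≤ b → b ≤ a → a < 58 → R r (a + b) < R r a * R r b

abstract
  finite₀ : FiniteRange 0 12
  finite₀ = rank-sound (table-isTable 115 115) ≤-refl 0 12 refl
  finite₁ : FiniteRange 1 11
  finite₁ = rank-sound (table-isTable 115 115) ≤-refl 1 11 refl
  finite₂ : FiniteRange 2 11
  finite₂ = rank-sound (table-isTable 115 115) ≤-refl 2 11 refl

q≤3R-pos : ∀ r n → 0 < n → q n n ≤ 3 * R r (2 + n)
q≤3R-pos r (suc n) _ = q≤3R r n

-- The shift 6 is spent here: 2 below each factor for `q≤3R`, and 2 above the sum for `3R≤q`. The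
-- three factors 3 leave exactly the 3 of `partition-super`.
R-super-large : ∀ r x y → 9 ≤ x → 56 ≤ y → R r ((2 + y) + (2 + x)) < R r (2 + y) * R r (2 + x)
R-super-large r x y 9≤x 56≤y = *-cancelˡ-< 9 _ _ (begin-strict
  9 * R r ((2 + y) + (2 + x))              ≡⟨ *-assoc 3 3 (R r ((2 + y) + (2 + x))) ⟩
  3 * (3 * R r ((2 + y) + (2 + x)))        ≤⟨ *-monoʳ-≤ 3 (3R≤q r ((2 + y) + (2 + x))) ⟩
  3 * q (2 + ((2 + y) + (2 + x))) (2 + ((2 + y) + (2 + x))) ≡⟨ cong (λ z → 3 * q z z) (move x y) ⟩
  3 * q (6 + (x + y)) (6 + (x + y))        <⟨ partition-super x y 9≤x 56≤y ⟩
  q x x * q y y                            ≤⟨ *-mono-≤ (q≤3R-pos r x (<-≤-trans z<s 9≤x)) (q≤3R-pos r y (<-≤-trans z<s 56≤y)) ⟩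
  (3 * R r (2 + x)) * (3 * R r (2 + y))    ≡⟨ join (R r (2 + x)) (R r (2 + y)) ⟩
  9 * (R r (2 + y) * R r (2 + x))          ∎)
  where
  open ≤-Reasoning
  move : ∀ x y → 2 + ((2 + y) + (2 + x)) ≡ 6 + (x + y)
  move = solve-∀
  join : ∀ u v → (3 * u) * (3 * v) ≡ 9 * (v * u)
  join = solve-∀

R-super-≥ : ∀ r lo → 11 ≤ lo → FiniteRange r lo → ∀ a b → lo ≤ b → b ≤ a → R r (a + b) < R r a * R r b
R-super-≥ r lo 11≤lo fin a b lo≤b b≤a with a <? 58
... | yes a<58 = fin a b lo≤b b≤a a<58
... | no  a≮58 = subst₂ (λ a b → R r (a + b) < R r a * R r b) (m+[n∸m]≡n (≤-trans (s≤s (s≤s z≤n)) 58≤a)) (m+[n∸m]≡n (≤-trans (s≤s (s≤s z≤n)) 11≤b))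
                   (R-super-large r (b ∸ 2) (a ∸ 2) (∸-monoˡ-≤ 2 11≤b) (∸-monoˡ-≤ 2 58≤a))
  where
  58≤a : 58 ≤ a
  58≤a = ≮⇒≥ a≮58
  11≤b : 11 ≤ b
  11≤b = ≤-trans 11≤lo lo≤b

R-super : ∀ r lo → 11 ≤ lo → FiniteRange r lo → ∀ a b → lo ≤ a → lo ≤ b → R r (a + b) < R r a * R r b
R-super r lo 11≤lo fin a b lo≤a lo≤b with ≤-total b a
... | inj₁ b≤a = R-super-≥ r lo 11≤lo fin a b lo≤b b≤a
... | inj₂ a≤b = subst₂ _<_ (cong (R r) (+-comm b a)) (*-comm (R r b) (R r a)) (R-super-≥ r lo 11≤lo fin b a lo≤a a≤b)

N-super : ∀ r → r < 3 → ∀ lo → 11 ≤ lo → FiniteRange r lo → ∀ a b → a ≥ lo → b ≥ lo →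
  N (+ r) 3 a * N (+ r) 3 b > N (+ r) 3 (a + b)
-- A positive `lo` forces `a` and `b` to be positive, where `N≡R` applies.
N-super r r<3 (suc lo) 11≤lo fin (suc a) (suc b) a≥ b≥ = subst₂ _<_ (sym (N≡R r r<3 (a + suc b)))
  (sym (cong₂ _*_ (N≡R r r<3 a) (N≡R r r<3 b))) (R-super r (suc lo) 11≤lo fin (suc a) (suc b) a≥ b≥)

theorem1p1 : ((a b : ℕ) → a ≥ 12 → b ≥ 12 → N (+ 0) 3 a * N (+ 0) 3 b > N (+ 0) 3 (a + b))
    × ((r : ℤ) → r ≡ + 1 ⊎ r ≡ + 2 → (a b : ℕ) → a ≥ 11 → b ≥ 11 → N r 3 a * N r 3 b > N r 3 (a + b))
theorem1p1 =
  N-super 0 (s≤s z≤n) 12 (n≤1+n 11) finite₀ ,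
  λ { _ (inj₁ refl) → N-super 1 (s≤s (s≤s z≤n)) 11 ≤-refl finite₁
    ; _ (inj₂ refl) → N-super 2 (s≤s (s≤s (s≤s z≤n))) 11 ≤-refl finite₂ }
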